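{- Let $G=K_{m_1,\ldots,m_k}$ be a complete multipartite graph with $k\ge 2$, $1\le m_1\le m_2\le\cdots\le m_k$ and $m_k\ge 2$. Let $\sigma:=|\{i\mid m_i=1\}|$ and $\lambda:=|\{i\mid m_i\ge 2\}|$. If $\lambda=1$, then $\operatorname{nim}(\mathrm{DNT}(G))=\operatorname{pty}(\sigma)$ and $\operatorname{nim}(\mathrm{TER}(G))=1+\operatorname{pty}(\sigma)$.
   Context: For a graph $G$ with vertex set $V$, a set $K\subseteq V$ is convex if it contains every vertex lying on any shortest path between two elements of $K$. The convex hull $[P]$ of $P\subseteq V$ is the smallest convex set containing $P$. For an integer $k$, $\operatorname{pty}(k):=k\bmod 2\in\{0,1\}$. The game $\mathrm{DNT}(G)$: positions are the sets $P\subseteq V$ with $[V\setminus P]=V$; the starting position is $\emptyset$; the options of $P$ are the sets $P\cup\{v\}$ with $v\in V\setminus P$ and $[V\setminus(P\cup\{v\})]=V$. The game $\mathrm{TER}(G)$: positions are the sets $P\subseteq V$ reachable from the starting position $\emptyset$ by the following moves. If $[V\setminus P]=V$, then the options of $P$ are all sets $P\cup\{v\}$ with $v\in V\setminus P$; if $[V\setminus P]\neq V$, then $P$ is terminal (has no options). The nim-value of a position is defined recursively by $\operatorname{nim}(p)=\operatorname{mex}\{\operatorname{nim}(q): q\text{ an option of }p\}$, where $\operatorname{mex}(A)$ is the smallest nonnegative integer not in $A$; the nim-value of a game is that of its starting position. -}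

module Defs where

open import Data.Fin as Fin using (Fin; zero; suc; splitAt)
open import Data.Fin.Properties as Fin using ()
open import Data.Fin.Subset as Subset using (Subset; inside; outside; _∪_; ⁅_⁆; ∁; ⋂)
open import Data.Fin.Subset.Induction using (⊃-wellFounded)
open import Data.Fin.Subset.Properties using (∈⊤; ∉⊥; p∩q⊆p; p∩q⊆q; x∈p∩q⁺; p⊆p∪q; q⊆p∪q; x∈⁅x⁆; x∉p⇒x∈∁p; ⊆-antisym; _⊆?_)
  renaming (_∈?_ to _∈ₛ?_)
open import Data.List using (List; []; _∷_; head; last; length; lookup; map; mapMaybe; filter; allFin; cartesianProductWith)
open import Data.List.Membership.DecPropositional using () renaming (_∈?_ to mem?)
open import Data.List.Membership.Propositional using (_∈_; _∉_; mapWith∈)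
open import Data.List.Membership.Propositional.Properties
  using (mapWith∈-cong; mapWith∈≗map; ∈-cartesianProductWith⁺; ∈-allFin; ∈-filter⁺; ∈-filter⁻; ∈-lookup)
import Data.List.Membership.Setoid.Properties as Membershipₛ
open import Data.List.Relation.Unary.All as All using (All; []; _∷_)
open import Data.List.Relation.Unary.AllPairs using ([]; _∷_)
open import Data.List.Relation.Unary.Any as Any using (here; there)
open import Data.List.Relation.Unary.Linked using (Linked; linked?)
open import Data.List.Relation.Unary.Unique.Propositional using (Unique)
import Data.List.Relation.Unary.Unique.DecPropositional as UniqueDec
open import Data.Maybe using (Maybe; just; nothing)
import Data.Maybe.Properties as Maybe
open import Data.Nat as ℕ using (ℕ; zero; suc; _+_; _≤_; _<_; s≤s; _%_)
import Data.Nat.Properties as ℕ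
open import Data.Product using (Σ-syntax; ∃-syntax; _×_; _,_; proj₁; proj₂)
open import Data.Sum using (inj₁; inj₂)
open import Data.Vec as Vec using (Vec; []; _∷_)
import Data.Vec.Properties as Vec
import Data.Bool.Properties as Bool
open import Function using (_∘_)
open import Induction.WellFounded using (WellFounded; Acc; acc; module Subrelation)
import Relation.Binary.Construct.On as On
open import Relation.Binary.Definitions using (Decidable; Symmetric; Irreflexive)
open import Relation.Binary.PropositionalEquality
  using (_≡_; _≢_; refl; sym; trans; cong; setoid)
open import Relation.Nullary using (Dec; yes; no; contradiction)
open import Relation.Nullary.Decidable using (map′; ¬?; _×-dec_; _→-dec_)
import Relation.Unary as U

record Graph (n : ℕ) : Set₁ where
  field
    Adj        : Fin n → Fin n → Set
    adj?       : Decidable Adj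
    adj-sym    : Symmetric Adj
    adj-irrefl : Irreflexive _≡_ Adj

-- The vertices of K[ m₁ ∷ … ∷ mₖ ] are split into consecutive blocks of
-- m₁, …, mₖ vertices.

block : ∀ {k} (ms : Vec ℕ k) → Fin (Vec.sum ms) → Fin k
block (m ∷ ms) v with splitAt m v
... | inj₁ _ = zero
... | inj₂ w = suc (block ms w)

K[_] : ∀ {k} (ms : Vec ℕ k) → Graph (Vec.sum ms)
K[ ms ] = record
  { Adj        = λ u v → block ms u ≢ block ms v
  ; adj?       = λ u v → ¬? (block ms u Fin.≟ block ms v)
  ; adj-sym    = λ u≁v eq → u≁v (sym eq)
  ; adj-irrefl = λ { refl u≁u → u≁u refl }
  }

-- A path is given by its list of vertices; all paths have at least one
-- vertex, so comparing list lengths is the same as comparing numbers of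
-- edges.

IsPath : ∀ {n} → Graph n → Fin n → Fin n → List (Fin n) → Set
IsPath G u v xs =
  head xs ≡ just u × last xs ≡ just v × Linked (Graph.Adj G) xs × Unique xs

IsShortestPath : ∀ {n} → Graph n → Fin n → Fin n → List (Fin n) → Set
IsShortestPath G u v xs =
  IsPath G u v xs × (∀ ys → IsPath G u v ys → length xs ≤ length ys)

Convex : ∀ {n} → Graph n → Subset n → Set
Convex G K = ∀ u v xs → u Subset.∈ K → v Subset.∈ K → IsShortestPath G u v xs →
             All (Subset._∈ K) xs

-- Convexity is decidable because a path on n vertices has at most n of them.

listsUpTo : ∀ {n} → ℕ → List (List (Fin n))
listsUpTo     zero    = [] ∷ []
listsUpTo {n} (suc l) = [] ∷ cartesianProductWith _∷_ (allFin n) (listsUpTo l)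

∈-listsUpTo : ∀ {n} l (xs : List (Fin n)) → length xs ≤ l → xs ∈ listsUpTo l
∈-listsUpTo zero    []       _       = here refl
∈-listsUpTo (suc l) []       _       = here refl
∈-listsUpTo (suc l) (x ∷ xs) (s≤s p) =
  there (∈-cartesianProductWith⁺ _∷_ (∈-allFin x) (∈-listsUpTo l xs p))

lookup-injective : ∀ {A : Set} {xs : List A} → Unique xs → ∀ {i j} →
                   lookup xs i ≡ lookup xs j → i ≡ j
lookup-injective (_ ∷ _)  {zero}  {zero}  _  = refl
lookup-injective (p ∷ _)  {zero}  {suc j} eq = contradiction eq (All.lookup p (∈-lookup j))
lookup-injective (p ∷ _)  {suc i} {zero}  eq = contradiction (sym eq) (All.lookup p (∈-lookup i))
lookup-injective (_ ∷ ps) {suc i} {suc j} eq = cong suc (lookup-injective ps eq)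

unique⇒length≤ : ∀ {n} {xs : List (Fin n)} → Unique xs → length xs ≤ n
unique⇒length≤ u = Fin.injective⇒≤ (lookup-injective u)

allUnique? : ∀ {n} {P : List (Fin n) → Set} → U.Decidable P →
             Dec (∀ xs → Unique xs → P xs)
allUnique? {n} P? = map′
  (λ ps xs u → All.lookup ps (∈-listsUpTo n xs (unique⇒length≤ u)) u)
  (λ f → All.tabulate (λ {xs} _ → f xs))
  (All.all? (λ xs → UniqueDec.unique? Fin._≟_ xs →-dec P? xs) (listsUpTo n))

isPath? : ∀ {n} (G : Graph n) u v → U.Decidable (IsPath G u v)
isPath? G u v xs =
  Maybe.≡-dec Fin._≟_ (head xs) (just u) ×-dec
  Maybe.≡-dec Fin._≟_ (last xs) (just v) ×-dec
  linked? (Graph.adj? G) xs ×-dec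
  UniqueDec.unique? Fin._≟_ xs

isShortestPath? : ∀ {n} (G : Graph n) u v → U.Decidable (IsShortestPath G u v)
isShortestPath? G u v xs = isPath? G u v xs ×-dec
  map′ (λ f ys p → f ys (proj₂ (proj₂ (proj₂ p))) p) (λ f ys _ → f ys)
    (allUnique? (λ ys → isPath? G u v ys →-dec (length xs ℕ.≤? length ys)))

convex? : ∀ {n} (G : Graph n) → U.Decidable (Convex G)
convex? G K = Fin.all? λ u → Fin.all? λ v →
  map′ (λ f xs u∈ v∈ p → f xs (proj₂ (proj₂ (proj₂ (proj₁ p)))) u∈ v∈ p) (λ f xs _ → f xs)
    (allUnique? (λ xs → (u ∈ₛ? K) →-dec (v ∈ₛ? K) →-dec
                        isShortestPath? G u v xs →-dec All.all? (_∈ₛ? K) xs))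

sides : List Subset.Side
sides = inside ∷ outside ∷ []

subsets : ∀ n → List (Subset n)
subsets zero    = [] ∷ []
subsets (suc n) = cartesianProductWith _∷_ sides (subsets n)

∈-subsets : ∀ {n} (P : Subset n) → P ∈ subsets n
∈-subsets []            = here refl
∈-subsets (inside  ∷ P) = ∈-cartesianProductWith⁺ _∷_ {xs = sides} (here refl) (∈-subsets P)
∈-subsets (outside ∷ P) = ∈-cartesianProductWith⁺ _∷_ {xs = sides} (there (here refl)) (∈-subsets P)

⋂⁺ : ∀ {n} {x : Fin n} Ks → All (x Subset.∈_) Ks → x Subset.∈ ⋂ Ks
⋂⁺ []       []       = ∈⊤
⋂⁺ (K ∷ Ks) (p ∷ ps) = x∈p∩q⁺ (p , ⋂⁺ Ks ps)

⋂⊆ : ∀ {n} {K : Subset n} Ks → K ∈ Ks → ⋂ Ks Subset.⊆ K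
⋂⊆ (K ∷ Ks) (here refl) = p∩q⊆p K (⋂ Ks)
⋂⊆ (K ∷ Ks) (there K∈)  = ⋂⊆ Ks K∈ ∘ p∩q⊆q K (⋂ Ks)

-- The intersection of all convex sets containing P; it is the smallest one
-- by hull-least, ⊆-hull and hull-convex.  Opaque only to keep type checking
-- fast, as is generating? below.

opaque
  hull : ∀ {n} → Graph n → Subset n → Subset n
  hull G P = ⋂ (filter (λ K → convex? G K ×-dec (P ⊆? K)) (subsets _))

module _ {n} (G : Graph n) (P : Subset n) where
  private
    hull? : (K : Subset n) → Dec (Convex G K × P Subset.⊆ K)
    hull? K = convex? G K ×-dec (P ⊆? K)

  opaque
    unfolding hull

    hull-least : ∀ {K} → Convex G K → P Subset.⊆ K → hull G P Subset.⊆ K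
    hull-least {K} c P⊆K = ⋂⊆ _ (∈-filter⁺ hull? (∈-subsets K) (c , P⊆K))

    ⊆-hull : P Subset.⊆ hull G P
    ⊆-hull x∈P = ⋂⁺ _ (All.tabulate λ K∈ →
      proj₂ (proj₂ (∈-filter⁻ hull? {xs = subsets n} K∈)) x∈P)

    hull-convex : Convex G (hull G P)
    hull-convex u v xs u∈ v∈ sp = All.tabulate λ x∈xs → ⋂⁺ _ (All.tabulate λ K∈ →
      All.lookup (proj₁ (proj₂ (∈-filter⁻ hull? {xs = subsets n} K∈))
                    u v xs (⋂⊆ _ K∈ u∈) (⋂⊆ _ K∈ v∈) sp) x∈xs)

Generating : ∀ {n} → Graph n → Subset n → Set
Generating G Q = hull G Q ≡ Subset.⊤

opaque
  generating? : ∀ {n} (G : Graph n) → U.Decidable (Generating G)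
  generating? G Q = Vec.≡-dec Bool._≟_ (hull G Q) Subset.⊤

-- Fuel length xs suffices: if 0, …, length xs ∸ 1 all lie in xs, then
-- they exhaust it.

mexFrom : ℕ → ℕ → List ℕ → ℕ
mexFrom zero       k xs = k
mexFrom (suc fuel) k xs with mem? ℕ._≟_ k xs
... | yes _ = mexFrom fuel (suc k) xs
... | no  _ = k

mex : List ℕ → ℕ
mex xs = mexFrom (length xs) 0 xs

private
  <suc : ∀ {k xs} → k ∈ xs → (∀ {j} → j < k → j ∈ xs) → ∀ {j} → j < suc k → j ∈ xs
  <suc {k} k∈ below {j} j<1+k with ℕ.m≤n⇒m<n∨m≡n (ℕ.≤-pred j<1+k)
  ... | inj₁ j<k  = below j<k
  ... | inj₂ refl = k∈

  allBelow⇒≤length : ∀ k xs → (∀ {j} → j < k → j ∈ xs) → k ≤ length xs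
  allBelow⇒≤length k xs below = Fin.injective⇒≤ {f = λ i → Any.index (below (Fin.toℕ<n {k} i))}
    λ {i} {j} eq → Fin.toℕ-injective
      (Membershipₛ.index-injective (setoid ℕ) (below (Fin.toℕ<n i)) (below (Fin.toℕ<n j)) eq)

  mexFrom-correct : ∀ fuel k xs → fuel + k ≡ length xs → (∀ {j} → j < k → j ∈ xs) →
                    mexFrom fuel k xs ∉ xs × (∀ {j} → j < mexFrom fuel k xs → j ∈ xs)
  mexFrom-correct zero k xs refl below =
    (λ k∈ → ℕ.1+n≰n (allBelow⇒≤length (suc k) xs (<suc k∈ below))) , below
  mexFrom-correct (suc fuel) k xs eq below with mem? ℕ._≟_ k xs
  ... | yes k∈ = mexFrom-correct fuel (suc k) xs (trans (ℕ.+-suc fuel k) eq) (<suc k∈ below)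
  ... | no  k∉ = k∉ , below

mex-∉ : ∀ xs → mex xs ∉ xs
mex-∉ xs = proj₁ (mexFrom-correct (length xs) 0 xs (ℕ.+-identityʳ _) λ ())

<mex⇒∈ : ∀ xs {j} → j < mex xs → j ∈ xs
<mex⇒∈ xs = proj₂ (mexFrom-correct (length xs) 0 xs (ℕ.+-identityʳ _) λ ())

-- The list of options may contain repetitions, which do not affect the mex.

record Game : Set₁ where
  field
    Position : Set
    start    : Position
    options  : Position → List Position
    wf       : WellFounded (λ q p → q ∈ options p)

module _ (Γ : Game) where
  open Game Γ

  private
    nimAcc : ∀ p → Acc (λ q p → q ∈ options p) p → ℕ
    nimAcc p (acc rs) = mex (mapWith∈ (options p) (λ {q} q∈ → nimAcc q (rs q∈)))

    nimAcc-irr : ∀ p (a b : Acc (λ q p → q ∈ options p) p) → nimAcc p a ≡ nimAcc p b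
    nimAcc-irr p (acc rs) (acc rs′) = cong mex
      (mapWith∈-cong (options p) _ _ (λ {q} q∈ → nimAcc-irr q (rs q∈) (rs′ q∈)))

  nimAt : Position → ℕ
  nimAt p = nimAcc p (wf p)

  nimAt-unfold : ∀ p → nimAt p ≡ mex (map nimAt (options p))
  nimAt-unfold p = trans (unfold p (wf p)) (cong mex (mapWith∈≗map nimAt (options p)))
    where
    unfold : ∀ p (a : Acc (λ q p → q ∈ options p) p) →
             nimAcc p a ≡ mex (mapWith∈ (options p) (λ {q} _ → nimAt q))
    unfold p (acc rs) = cong mex
      (mapWith∈-cong (options p) _ _ (λ {q} q∈ → nimAcc-irr q (rs q∈) (wf q)))

nim : Game → ℕ
nim Γ = nimAt Γ (Game.start Γ)

∈-mapMaybe⁻ : ∀ {A B : Set} (f : A → Maybe B) xs {y} → y ∈ mapMaybe f xs →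
              ∃[ x ] x ∈ xs × f x ≡ just y
∈-mapMaybe⁻ f (x ∷ xs) y∈ with f x in eq
∈-mapMaybe⁻ f (x ∷ xs) y∈ | nothing with ∈-mapMaybe⁻ f xs y∈
... | z , z∈ , e = z , there z∈ , e
∈-mapMaybe⁻ f (x ∷ xs) (here refl) | just _ = x , here refl , eq
∈-mapMaybe⁻ f (x ∷ xs) (there y∈)  | just _ with ∈-mapMaybe⁻ f xs y∈
... | z , z∈ , e = z , there z∈ , e

∈-mapMaybe⁺ : ∀ {A B : Set} (f : A → Maybe B) {xs x y} → x ∈ xs → f x ≡ just y →
              y ∈ mapMaybe f xs
∈-mapMaybe⁺ f {x ∷ xs} (here refl) e with f x
∈-mapMaybe⁺ f {x ∷ xs} (here refl) refl | just _ = here refl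
∈-mapMaybe⁺ f {x ∷ xs} (there x∈) e with f x
... | nothing = ∈-mapMaybe⁺ f x∈ e
... | just _  = there (∈-mapMaybe⁺ f x∈ e)

⊂-insert : ∀ {n} {P : Subset n} {v} → v Subset.∉ P → P Subset.⊂ (P ∪ ⁅ v ⁆)
⊂-insert {P = P} {v} v∉P = p⊆p∪q ⁅ v ⁆ , v , q⊆p∪q P ⁅ v ⁆ (x∈⁅x⁆ v) , v∉P

module _ {n} (G : Graph n) where

  DNTPosition : Set
  DNTPosition = Σ[ P ∈ Subset n ] Generating G (∁ P)

  DNTMove : DNTPosition → Fin n → Maybe DNTPosition
  DNTMove (P , _) v with v ∈ₛ? P | generating? G (∁ (P ∪ ⁅ v ⁆))
  ... | no _ | yes g = just (P ∪ ⁅ v ⁆ , g)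
  ... | _    | _     = nothing

  DNTOptions : DNTPosition → List DNTPosition
  DNTOptions p = mapMaybe (DNTMove p) (allFin n)

  ∁⊥-generating : Generating G (∁ Subset.⊥)
  ∁⊥-generating = ⊆-antisym (λ _ → ∈⊤)
    (λ _ → ⊆-hull G _ (x∉p⇒x∈∁p ∉⊥))

  DNTMove-⊃ : ∀ p v {q} → DNTMove p v ≡ just q → proj₁ q Subset.⊃ proj₁ p
  DNTMove-⊃ (P , _) v e with v ∈ₛ? P | generating? G (∁ (P ∪ ⁅ v ⁆))
  DNTMove-⊃ (P , _) v refl | no v∉P | yes _ = ⊂-insert v∉P
  DNTMove-⊃ (P , _) v ()   | no _   | no _
  DNTMove-⊃ (P , _) v ()   | yes _  | _

  DNT : Game
  DNT = record
    { Position = DNTPosition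
    ; start    = Subset.⊥ , ∁⊥-generating
    ; options  = DNTOptions
    ; wf       = Subrelation.wellFounded
        (λ {q} {p} q∈ → let v , _ , e = ∈-mapMaybe⁻ (DNTMove p) (allFin n) q∈ in DNTMove-⊃ p v e)
        (On.wellFounded proj₁ ⊃-wellFounded)
    }

  data Reachable : Subset n → Set where
    start : Reachable Subset.⊥
    move  : ∀ {P v} → Reachable P → Generating G (∁ P) → v Subset.∉ P →
            Reachable (P ∪ ⁅ v ⁆)

  TERPosition : Set
  TERPosition = Σ[ P ∈ Subset n ] Reachable P

  TERMove : TERPosition → Fin n → Maybe TERPosition
  TERMove (P , r) v with generating? G (∁ P) | v ∈ₛ? P
  ... | yes g | no v∉P = just (P ∪ ⁅ v ⁆ , move r g v∉P)
  ... | _     | _      = nothing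

  TEROptions : TERPosition → List TERPosition
  TEROptions p = mapMaybe (TERMove p) (allFin n)

  TERMove-⊃ : ∀ p v {q} → TERMove p v ≡ just q → proj₁ q Subset.⊃ proj₁ p
  TERMove-⊃ (P , r) v e with generating? G (∁ P) | v ∈ₛ? P
  TERMove-⊃ (P , r) v refl | yes _ | no v∉P = ⊂-insert v∉P
  TERMove-⊃ (P , r) v ()   | yes _ | yes _
  TERMove-⊃ (P , r) v ()   | no _  | _

  TER : Game
  TER = record
    { Position = TERPosition
    ; start    = Subset.⊥ , start
    ; options  = TEROptions
    ; wf       = Subrelation.wellFounded
        (λ {q} {p} q∈ → let v , _ , e = ∈-mapMaybe⁻ (TERMove p) (allFin n) q∈ in TERMove-⊃ p v e)
        (On.wellFounded proj₁ ⊃-wellFounded)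
    }

pty : ℕ → ℕ
pty k = k % 2

countOnes : ∀ {k} → Vec ℕ k → ℕ
countOnes = Vec.count (ℕ._≟ 1)

countAtLeastTwo : ∀ {k} → Vec ℕ k → ℕ
countAtLeastTwo = Vec.count (2 ℕ.≤?_)

{-# OPTIONS --safe #-}
module Submission where

-- Let A be the set of the σ vertices forming singleton blocks and B the
-- remaining block.  The vertices of A are adjacent to all others and B is
-- independent.  Removing a vertex of B from V leaves a convex set, while two
-- vertices of B have every vertex of A on a geodesic between them; hence a set
-- generates V exactly when it contains B, i.e. V ∖ P generates V exactly when
-- P ⊆ A.  So DNT is the game of taking the σ vertices of A one at a time, of
-- nim-value pty σ, and TER is the same game where every such position has in
-- addition terminal options of nim-value 0, given by the vertices of B; these
-- raise the nim-value by one.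

open import Defs
open import Data.Fin using (Fin; zero; suc; splitAt; _↑ˡ_; _↑ʳ_)
open import Data.Fin.Properties using (any?; splitAt-↑ˡ; splitAt-↑ʳ; splitAt⁻¹-↑ˡ; splitAt⁻¹-↑ʳ; ↑ˡ-injective; ↑ʳ-injective)
open import Data.Fin.Subset as Subset using (Subset; outside; inside; ⁅_⁆; ∁; ∣_∣; _∪_)
open import Data.Fin.Subset.Properties using (_∈?_; x∈p∪q⁻; x∈p∪q⁺; x∈⁅x⁆; x∈⁅y⁆⇒x≡y; x∉p⇒x∈∁p; x∈∁p⇒x∉p; ⊆-antisym; ∈⊤; ∉⊥; ∣⊥∣≡0; ∪-identityʳ; p⊆q⇒∣p∣≤∣q∣)
open import Data.List.Base as List using (List; []; _∷_; length)
open import Data.List.Membership.Propositional using (_∈_; _∉_)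
open import Data.List.Membership.Propositional.Properties using (∈-map⁺; ∈-map⁻; ∈-allFin)
open import Data.List.Relation.Unary.All as All using (All; []; _∷_)
open import Data.List.Relation.Unary.AllPairs using ([]; _∷_)
open import Data.List.Relation.Unary.Any using (here; there)
open import Data.List.Relation.Unary.Linked using ([-]; _∷_)
open import Data.Maybe.Base using (just)
open import Data.Nat using (ℕ; zero; suc; _+_; _≤_; _<_; z≤n; s≤s)
import Data.Nat as ℕ
open import Data.Nat.Properties as ℕ using (≤-reflexive; ≤-trans; <-cmp; n≮n; +-identityʳ; +-suc)
open import Data.Product using (∃-syntax; _×_; _,_; proj₁; proj₂)
open import Data.Sum using (inj₁; inj₂)
open import Data.Vec using (Vec; head; last)
import Data.Vec as Vec
open import Data.Vec.Base using ([]; _∷_; count; lookup; replicate; _++_)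
open import Data.Vec.Properties using (lookup-splitAt; lookup-replicate; lookup⇒[]=; []=⇒lookup)
open import Data.Vec.Relation.Unary.Linked using (Linked)
open import Function.Base using (_∘_)
open import Relation.Binary.Definitions using (tri<; tri≈; tri>)
open import Relation.Binary.PropositionalEquality using (_≡_; _≢_; refl; sym; trans; cong; subst)
open import Relation.Nullary using (¬_; yes; no; contradiction; does)
open import Relation.Nullary.Decidable using (_×-dec_; ¬?; decidable-stable; dec-true; dec-false)
open import Relation.Unary using (Decidable)

-- Values of mex

mex-unique : ∀ {k} xs → k ∉ xs → (∀ {j} → j < k → j ∈ xs) → mex xs ≡ k
mex-unique {k} xs k∉ below with <-cmp (mex xs) k
... | tri< m<k _ _ = contradiction (below m<k) (mex-∉ xs)
... | tri≈ _ m≡k _ = m≡k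
... | tri> _ _ k<m = contradiction (<mex⇒∈ xs k<m) k∉

-- `pty` has period two by computation, so only the mex of the value set {0}, which is 1, and that
-- of {1}, which is 0, have to be found.
mex-pty : ∀ r xs → All (_≡ pty r) xs → pty r ∈ xs → mex xs ≡ pty (suc r)
mex-pty 0 xs only 0∈ = mex-unique xs
  (λ 1∈ → contradiction (All.lookup only 1∈) λ ()) λ { (s≤s z≤n) → 0∈ }
mex-pty 1 xs only _ = mex-unique xs
  (λ 0∈ → contradiction (All.lookup only 0∈) λ ()) λ ()
mex-pty (suc (suc r)) = mex-pty r

-- The value sets are {0, 1} with mex 2 and {0, 2} with mex 1; the 0 comes from the terminal options
-- of TER.
mex-0-1+pty : ∀ r xs → 0 ∈ xs → 1 + pty r ∈ xs → (∀ {x} → x ∈ xs → x ≢ 0 → x ≡ 1 + pty r) →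
              mex xs ≡ 1 + pty (suc r)
mex-0-1+pty 0 xs 0∈ 1∈ only = mex-unique xs
  (λ 2∈ → contradiction (only 2∈ λ ()) λ ())
  λ { (s≤s z≤n) → 0∈ ; (s≤s (s≤s z≤n)) → 1∈ }
mex-0-1+pty 1 xs 0∈ _ only = mex-unique xs
  (λ 1∈ → contradiction (only 1∈ λ ()) λ ()) λ { (s≤s z≤n) → 0∈ }
mex-0-1+pty (suc (suc r)) = mex-0-1+pty r

-- Cardinalities of subsets

∣p∪⁅x⁆∣≡1+∣p∣ : ∀ {n} {P : Subset n} {v} → v Subset.∉ P → ∣ P ∪ ⁅ v ⁆ ∣ ≡ suc ∣ P ∣
∣p∪⁅x⁆∣≡1+∣p∣ {P = outside ∷ P} {zero}  v∉P = cong (suc ∘ ∣_∣) (∪-identityʳ P)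
∣p∪⁅x⁆∣≡1+∣p∣ {P = inside  ∷ P} {zero}  v∉P = contradiction Vec.here v∉P
∣p∪⁅x⁆∣≡1+∣p∣ {P = outside ∷ P} {suc v} v∉P = ∣p∪⁅x⁆∣≡1+∣p∣ (v∉P ∘ Vec.there)
∣p∪⁅x⁆∣≡1+∣p∣ {P = inside  ∷ P} {suc v} v∉P = cong suc (∣p∪⁅x⁆∣≡1+∣p∣ (v∉P ∘ Vec.there))

∣p∣<∣q∣⇒∃∈q∖p : ∀ {n} {P Q : Subset n} → ∣ P ∣ < ∣ Q ∣ → ∃[ v ] v Subset.∈ Q × v Subset.∉ P
∣p∣<∣q∣⇒∃∈q∖p {P = P} {Q} p<q with any? (λ v → (v ∈? Q) ×-dec ¬? (v ∈? P))
... | yes ex = ex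
... | no ∄ = contradiction (≤-trans p<q (p⊆q⇒∣p∣≤∣q∣ Q⊆P)) (n≮n _)
  where
  Q⊆P : Q Subset.⊆ P
  Q⊆P {v} v∈Q = decidable-stable (v ∈? P) λ v∉P → ∄ (v , v∈Q , v∉P)

insert-⊆ : ∀ {n} {P Q : Subset n} {v} → P Subset.⊆ Q → v Subset.∈ Q → (P ∪ ⁅ v ⁆) Subset.⊆ Q
insert-⊆ {P = P} {v = v} P⊆Q v∈Q x∈ with x∈p∪q⁻ P ⁅ v ⁆ x∈
... | inj₁ x∈P = P⊆Q x∈P
... | inj₂ x∈v = subst (Subset._∈ _) (sym (x∈⁅y⁆⇒x≡y v x∈v)) v∈Q

v∈insert : ∀ {n} (P : Subset n) v → v Subset.∈ (P ∪ ⁅ v ⁆)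
v∈insert P v = x∈p∪q⁺ (inj₂ (x∈⁅x⁆ v))

∣++∣ : ∀ {m n} (p : Subset m) (q : Subset n) → ∣ p ++ q ∣ ≡ ∣ p ∣ + ∣ q ∣
∣++∣ []            q = refl
∣++∣ (inside  ∷ p) q = cong suc (∣++∣ p q)
∣++∣ (outside ∷ p) q = ∣++∣ p q

-- Games in which V ∖ P is generating exactly when P ⊆ A

module _ {n} {G : Graph n} where

  DNTOptions⁻ : ∀ p {q} → q ∈ DNTOptions G p →
                ∃[ v ] v Subset.∉ proj₁ p × proj₁ q ≡ proj₁ p ∪ ⁅ v ⁆
  DNTOptions⁻ p q∈ with ∈-mapMaybe⁻ (DNTMove G p) (List.allFin n) q∈
  ... | v , _ , e with v ∈? proj₁ p | generating? G (∁ (proj₁ p ∪ ⁅ v ⁆)) | e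
  ... | no v∉P | yes _ | refl = v , v∉P , refl
  ... | no _   | no _  | ()
  ... | yes _  | _     | ()

  DNTOptions⁺ : ∀ p {v} → v Subset.∉ proj₁ p → Generating G (∁ (proj₁ p ∪ ⁅ v ⁆)) →
                ∃[ q ] q ∈ DNTOptions G p × proj₁ q ≡ proj₁ p ∪ ⁅ v ⁆
  DNTOptions⁺ p {v} v∉P gen = let q , e , eq = move≡just in q , ∈-mapMaybe⁺ _ (∈-allFin v) e , eq
    where
    move≡just : ∃[ q ] DNTMove G p v ≡ just q × proj₁ q ≡ proj₁ p ∪ ⁅ v ⁆
    move≡just with v ∈? proj₁ p | generating? G (∁ (proj₁ p ∪ ⁅ v ⁆))
    ... | yes v∈P | _      = contradiction v∈P v∉P
    ... | no _    | yes g  = _ , refl , refl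
    ... | no _    | no ¬g  = contradiction gen ¬g

  TEROptions⁻ : ∀ p {q} → q ∈ TEROptions G p →
                Generating G (∁ (proj₁ p)) ×
                ∃[ v ] v Subset.∉ proj₁ p × proj₁ q ≡ proj₁ p ∪ ⁅ v ⁆
  TEROptions⁻ p q∈ with ∈-mapMaybe⁻ (TERMove G p) (List.allFin n) q∈
  ... | v , _ , e with generating? G (∁ (proj₁ p)) | v ∈? proj₁ p | e
  ... | yes g | no v∉P | refl = g , v , v∉P , refl
  ... | yes _ | yes _  | ()
  ... | no _  | _      | ()

  TEROptions⁺ : ∀ p {v} → Generating G (∁ (proj₁ p)) → v Subset.∉ proj₁ p →
                ∃[ q ] q ∈ TEROptions G p × proj₁ q ≡ proj₁ p ∪ ⁅ v ⁆
  TEROptions⁺ p {v} gen v∉P = let q , e , eq = move≡just in q , ∈-mapMaybe⁺ _ (∈-allFin v) e , eq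
    where
    move≡just : ∃[ q ] TERMove G p v ≡ just q × proj₁ q ≡ proj₁ p ∪ ⁅ v ⁆
    move≡just with generating? G (∁ (proj₁ p)) | v ∈? proj₁ p
    ... | no ¬g | _       = contradiction gen ¬g
    ... | yes _ | yes v∈P = contradiction v∈P v∉P
    ... | yes _ | no _    = _ , refl , refl

-- Nim-values by the number r of vertices of A not yet taken

module _ {n} {G : Graph n} {A : Subset n}
         (generating⇒⊆ : ∀ P → Generating G (∁ P) → P Subset.⊆ A)
         (⊆⇒generating : ∀ P → P Subset.⊆ A → Generating G (∁ P))
         where

  private
    full : ∀ {P : Subset n} {v} → ∣ P ∣ + 0 ≡ ∣ A ∣ → v Subset.∉ P → ¬ (P ∪ ⁅ v ⁆) Subset.⊆ A
    full {P} eq v∉P Pv⊆A = n≮n _ (≤-trans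
      (≤-reflexive (sym (∣p∪⁅x⁆∣≡1+∣p∣ v∉P)))
      (≤-trans (p⊆q⇒∣p∣≤∣q∣ Pv⊆A) (≤-reflexive (trans (sym eq) (+-identityʳ ∣ P ∣)))))

    free : ∀ {P : Subset n} {r} → ∣ P ∣ + suc r ≡ ∣ A ∣ → ∃[ v ] v Subset.∈ A × v Subset.∉ P
    free {P} {r} eq = ∣p∣<∣q∣⇒∃∈q∖p
      (≤-trans (s≤s (ℕ.m≤m+n ∣ P ∣ r)) (≤-reflexive (trans (sym (+-suc ∣ P ∣ r)) eq)))

    step : ∀ {P : Subset n} {v r} → ∣ P ∣ + suc r ≡ ∣ A ∣ → v Subset.∉ P → ∣ P ∪ ⁅ v ⁆ ∣ + r ≡ ∣ A ∣
    step {P} {r = r} eq v∉P = trans (cong (_+ r) (∣p∪⁅x⁆∣≡1+∣p∣ v∉P)) (trans (sym (+-suc ∣ P ∣ r)) eq)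

  -- Induction on r: the position carries a proof that it lies inside A, and each option takes one
  -- more vertex of A, so all options share one value.
  nimAt-DNT : ∀ r p → ∣ proj₁ p ∣ + r ≡ ∣ A ∣ → nimAt (DNT G) p ≡ pty r
  nimAt-DNT zero p eq = trans (nimAt-unfold (DNT G) p) (mex-unique _ 0∉ λ ())
    where
    0∉ : 0 ∉ List.map (nimAt (DNT G)) (DNTOptions G p)
    0∉ 0∈ with ∈-map⁻ _ 0∈
    ... | q , q∈ , _ with DNTOptions⁻ p q∈
    ... | v , v∉P , e = full eq v∉P
      (subst (Subset._⊆ A) e (generating⇒⊆ _ (proj₂ q)))
  nimAt-DNT (suc r) p eq = trans (nimAt-unfold (DNT G) p)
    (mex-pty r _ (All.tabulate only) present)
    where
    nims = List.map (nimAt (DNT G)) (DNTOptions G p)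

    value : ∀ {q v} → v Subset.∉ proj₁ p → proj₁ q ≡ proj₁ p ∪ ⁅ v ⁆ → nimAt (DNT G) q ≡ pty r
    value {q} v∉P e = nimAt-DNT r q (trans (cong (λ Q → ∣ Q ∣ + r) e) (step eq v∉P))

    only : ∀ {x} → x ∈ nims → x ≡ pty r
    only x∈ with ∈-map⁻ _ x∈
    ... | q , q∈ , refl with DNTOptions⁻ p q∈
    ... | _ , v∉P , e = value {q} v∉P e

    present : pty r ∈ nims
    -- A vertex of A is still free, so there is at least one option and the common value really
    -- occurs.
    present with free eq
    ... | v , v∈A , v∉P
      with DNTOptions⁺ p v∉P (⊆⇒generating _ (insert-⊆ (generating⇒⊆ _ (proj₂ p)) v∈A))
    ... | q , q∈ , e = subst (_∈ nims) (value {q} v∉P e) (∈-map⁺ _ q∈)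

  nim-DNT : nim (DNT G) ≡ pty ∣ A ∣
  nim-DNT = nimAt-DNT ∣ A ∣ _ (cong (_+ ∣ A ∣) (∣⊥∣≡0 n))

  -- An option of p would witness that the complement of p generates, forcing p into A; hence p is
  -- terminal.
  nimAt-TER-⊈ : ∀ p → ¬ proj₁ p Subset.⊆ A → nimAt (TER G) p ≡ 0
  nimAt-TER-⊈ p p⊈A = trans (nimAt-unfold (TER G) p) (mex-unique _ 0∉ λ ())
    where
    0∉ : 0 ∉ List.map (nimAt (TER G)) (TEROptions G p)
    0∉ 0∈ with ∈-map⁻ _ 0∈
    ... | q , q∈ , _ = p⊈A (generating⇒⊆ _ (proj₁ (TEROptions⁻ p q∈)))

  module _ {b} (b∉A : b Subset.∉ A) where

    0∈TER-options : ∀ p → proj₁ p Subset.⊆ A →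
                    0 ∈ List.map (nimAt (TER G)) (TEROptions G p)
    0∈TER-options p p⊆A with TEROptions⁺ p (⊆⇒generating _ p⊆A) (b∉A ∘ p⊆A)
    ... | q , q∈ , e = subst (_∈ List.map (nimAt (TER G)) (TEROptions G p))
      (nimAt-TER-⊈ q λ q⊆A → b∉A (q⊆A (subst (b Subset.∈_) (sym e) (v∈insert (proj₁ p) b))))
      (∈-map⁺ _ q∈)

    -- A TER position may leave A, so containment in A is an explicit invariant here.
    nimAt-TER : ∀ r p → proj₁ p Subset.⊆ A → ∣ proj₁ p ∣ + r ≡ ∣ A ∣ →
                nimAt (TER G) p ≡ 1 + pty r
    -- The induction step along a move inside A, mutually recursive with `nimAt-TER`.
    nimAt-TER-option : ∀ r p → proj₁ p Subset.⊆ A → ∣ proj₁ p ∣ + suc r ≡ ∣ A ∣ →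
                       ∀ q {v} → v Subset.∈ A → v Subset.∉ proj₁ p →
                       proj₁ q ≡ proj₁ p ∪ ⁅ v ⁆ → nimAt (TER G) q ≡ 1 + pty r
    nimAt-TER-option r p p⊆A eq q v∈A v∉P e = nimAt-TER r q
      (subst (Subset._⊆ A) (sym e) (insert-⊆ p⊆A v∈A))
      (trans (cong (λ Q → ∣ Q ∣ + r) e) (step eq v∉P))

    nimAt-TER zero p p⊆A eq = trans (nimAt-unfold (TER G) p)
      (mex-unique _ 1∉ λ { (s≤s z≤n) → 0∈TER-options p p⊆A })
      where
      -- With A exhausted every move leaves A and reaches a terminal position, so 0 is the only
      -- option value.
      1∉ : 1 ∉ List.map (nimAt (TER G)) (TEROptions G p)
      1∉ 1∈ with ∈-map⁻ _ 1∈
      ... | q , q∈ , 1≡ with TEROptions⁻ p q∈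
      ... | _ , v , v∉P , e = contradiction
        (trans 1≡ (nimAt-TER-⊈ q (full eq v∉P ∘ subst (Subset._⊆ A) e))) λ ()
    nimAt-TER (suc r) p p⊆A eq = trans (nimAt-unfold (TER G) p)
      (mex-0-1+pty r _ (0∈TER-options p p⊆A) present only)
      where
      nims = List.map (nimAt (TER G)) (TEROptions G p)

      present : 1 + pty r ∈ nims
      present with free eq
      ... | v , v∈A , v∉P with TEROptions⁺ p (⊆⇒generating _ p⊆A) v∉P
      ... | q , q∈ , e =
        subst (_∈ nims) (nimAt-TER-option r p p⊆A eq q v∈A v∉P e) (∈-map⁺ _ q∈)

      only : ∀ {x} → x ∈ nims → x ≢ 0 → x ≡ 1 + pty r
      only x∈ x≢0 with ∈-map⁻ _ x∈
      ... | q , q∈ , refl with TEROptions⁻ p q∈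
      -- A move outside A is terminal with value 0, which `x≢0` excludes.
      ... | _ , v , v∉P , e with v ∈? A
      ... | yes v∈A = nimAt-TER-option r p p⊆A eq q v∈A v∉P e
      ... | no  v∉A = contradiction
        (nimAt-TER-⊈ q λ q⊆A → v∉A (q⊆A (subst (v Subset.∈_) (sym e) (v∈insert (proj₁ p) v))))
        x≢0

    nim-TER : nim (TER G) ≡ 1 + pty ∣ A ∣
    nim-TER = nimAt-TER ∣ A ∣ _ (λ x∈⊥ → contradiction x∈⊥ ∉⊥) (cong (_+ ∣ A ∣) (∣⊥∣≡0 n))

-- Generating sets of a graph made of universal vertices and an independent set

last-∈ : ∀ {X : Set} {v : X} xs → List.last xs ≡ just v → v ∈ xs
last-∈ (x ∷ [])     refl = here refl
last-∈ (x ∷ y ∷ xs) eq   = there (last-∈ (y ∷ xs) eq)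

module _ {n} (G : Graph n) (A : Subset n)
         (universal   : ∀ {x y} → x Subset.∈ A → x ≢ y → Graph.Adj G x y)
         (independent : ∀ {x y} → x Subset.∉ A → y Subset.∉ A → ¬ Graph.Adj G x y)
         where

  open Graph G

  -- A geodesic u, y, z, … , v leaving u ∉ A steps to some y ∈ A, which is
  -- adjacent to v (for u ∈ A already u is), so the geodesic has no interior vertex other than y.
  geodesic-avoids : ∀ {b u v xs} → b Subset.∉ A → u ≢ b → v ≢ b →
                    IsShortestPath G u v xs → All (_≢ b) xs
  geodesic-avoids {xs = _ ∷ []} b∉A u≢b v≢b ((refl , _) , _) = u≢b ∷ []
  geodesic-avoids {xs = _ ∷ _ ∷ []} b∉A u≢b v≢b ((refl , refl , _) , _) = u≢b ∷ v≢b ∷ []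
  geodesic-avoids {b} {u} {v} {_ ∷ y ∷ z ∷ zs} b∉A u≢b v≢b
    ((refl , last≡v , u~y ∷ _ , (u≢y ∷ u≢zs) ∷ y≢zs ∷ _) , shortest) = go zs last≡v shortest
    where
    v∈ : v ∈ z ∷ zs
    v∈ = last-∈ (z ∷ zs) last≡v

    u≢v : u ≢ v
    u≢v = All.lookup u≢zs v∈

    y≢v : y ≢ v
    y≢v = All.lookup y≢zs v∈

    u∉A : (∀ ys → IsPath G u v ys → 3 ≤ length ys) → u Subset.∉ A
    u∉A long u∈A with long (u ∷ v ∷ []) (refl , refl , universal u∈A u≢v ∷ [-] , (u≢v ∷ []) ∷ [] ∷ [])
    ... | s≤s (s≤s ())

    y∈A : u Subset.∉ A → y Subset.∈ A
    y∈A u∉A = decidable-stable (y ∈? A) λ y∉A → independent u∉A y∉A u~y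

    uyv : u Subset.∉ A → IsPath G u v (u ∷ y ∷ v ∷ [])
    uyv u∉A = refl , refl , u~y ∷ universal (y∈A u∉A) y≢v ∷ [-] ,
              (u≢y ∷ u≢v ∷ []) ∷ (y≢v ∷ []) ∷ [] ∷ []

    go : ∀ zs → List.last (z ∷ zs) ≡ just v →
         (∀ ys → IsPath G u v ys → 3 + length zs ≤ length ys) → All (_≢ b) (u ∷ y ∷ z ∷ zs)
    -- The interior vertex y lies in A and b does not; with four or more vertices the path u, y, v
    -- would be shorter.
    go [] refl sh = u≢b ∷ (λ { refl → b∉A (y∈A (u∉A sh)) }) ∷ v≢b ∷ []
    go (_ ∷ zs) _ sh with sh _ (uyv (u∉A λ ys p → ≤-trans (ℕ.m≤m+n 3 _) (sh ys p)))
    ... | s≤s (s≤s (s≤s ()))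

  ∁⁅b⁆-convex : ∀ {b} → b Subset.∉ A → Convex G (∁ ⁅ b ⁆)
  ∁⁅b⁆-convex {b} b∉A u v xs u∈ v∈ sp = All.map
    (λ x≢b → x∉p⇒x∈∁p (x≢b ∘ x∈⁅y⁆⇒x≡y b)) (geodesic-avoids b∉A (≢b u∈) (≢b v∈) sp)
    where
    ≢b : ∀ {x} → x Subset.∈ ∁ ⁅ b ⁆ → x ≢ b
    ≢b x∈ refl = x∈∁p⇒x∉p x∈ (x∈⁅x⁆ b)

  -- If P contained some b outside A, the hull of its complement would stay inside the convex set
  -- `∁ ⁅ b ⁆` and miss b.
  generating⇒⊆universal : ∀ P → Generating G (∁ P) → P Subset.⊆ A
  generating⇒⊆universal P gen {b} b∈P = decidable-stable (b ∈? A) λ b∉A →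
    x∈∁p⇒x∉p
      (hull-least G (∁ P) (∁⁅b⁆-convex b∉A) ∁P⊆∁⁅b⁆ (subst (b Subset.∈_) (sym gen) ∈⊤))
      (x∈⁅x⁆ b)
    where
    ∁P⊆∁⁅b⁆ : ∁ P Subset.⊆ ∁ ⁅ b ⁆
    ∁P⊆∁⁅b⁆ x∈ = x∉p⇒x∈∁p λ x∈b →
      x∈∁p⇒x∉p x∈ (subst (Subset._∈ P) (sym (x∈⁅y⁆⇒x≡y b x∈b)) b∈P)

  -- b and b′ are distinct and not adjacent, so no path between them has fewer than three vertices.
  geodesic-through : ∀ {a b b′} → a Subset.∈ A → b Subset.∉ A → b′ Subset.∉ A → b ≢ b′ →
                     IsShortestPath G b b′ (b ∷ a ∷ b′ ∷ [])
  geodesic-through {a} {b} {b′} a∈A b∉A b′∉A b≢b′ =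
    (refl , refl , adj-sym (universal a∈A a≢b) ∷ universal a∈A a≢b′ ∷ [-] ,
      ((a≢b ∘ sym) ∷ b≢b′ ∷ []) ∷ (a≢b′ ∷ []) ∷ [] ∷ []) , shortest
    where
    a≢b : a ≢ b
    a≢b refl = b∉A a∈A

    a≢b′ : a ≢ b′
    a≢b′ refl = b′∉A a∈A

    shortest : ∀ ys → IsPath G b b′ ys → 3 ≤ length ys
    shortest (_ ∷ [])         (refl , refl , _)            = contradiction refl b≢b′
    shortest (_ ∷ _ ∷ [])     (refl , refl , b~b′ ∷ _ , _) = contradiction b~b′ (independent b∉A b′∉A)
    shortest (_ ∷ _ ∷ _ ∷ ys) _                            = ℕ.m≤m+n 3 _

  -- All vertices outside A survive in `∁ P`, and each vertex of A is the midpoint of a geodesic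
  -- from b to b′.
  ⊆universal⇒generating : ∀ {b b′} → b Subset.∉ A → b′ Subset.∉ A → b ≢ b′ →
                          ∀ P → P Subset.⊆ A → Generating G (∁ P)
  ⊆universal⇒generating {b} {b′} b∉A b′∉A b≢b′ P P⊆A = ⊆-antisym (λ _ → ∈⊤) (λ {x} _ → x∈hull x)
    where
    ∉A⇒∈hull : ∀ {x} → x Subset.∉ A → x Subset.∈ hull G (∁ P)
    ∉A⇒∈hull x∉A = ⊆-hull G (∁ P) (x∉p⇒x∈∁p (x∉A ∘ P⊆A))

    x∈hull : ∀ x → x Subset.∈ hull G (∁ P)
    x∈hull x with x ∈? A
    ... | no x∉A = ∉A⇒∈hull x∉A
    ... | yes x∈A with hull-convex G (∁ P) b b′ _ (∉A⇒∈hull b∉A) (∉A⇒∈hull b′∉A)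
                         (geodesic-through x∈A b∉A b′∉A b≢b′)
    ... | _ ∷ x∈ ∷ _ = x∈

-- The blocks of a complete multipartite graph

-- Coordinates inverse to `block`: a block together with a position in it.
vertex : ∀ {k} (ms : Vec ℕ k) i → Fin (lookup ms i) → Fin (Vec.sum ms)
vertex (m ∷ ms) zero    j = j ↑ˡ Vec.sum ms
vertex (m ∷ ms) (suc i) j = m ↑ʳ vertex ms i j

block-vertex : ∀ {k} (ms : Vec ℕ k) i j → block ms (vertex ms i j) ≡ i
block-vertex (m ∷ ms) zero    j rewrite splitAt-↑ˡ m j (Vec.sum ms) = refl
block-vertex (m ∷ ms) (suc i) j rewrite splitAt-↑ʳ m (Vec.sum ms) (vertex ms i j) =
  cong suc (block-vertex ms i j)

vertex-injective : ∀ {k} (ms : Vec ℕ k) i {j j′} → vertex ms i j ≡ vertex ms i j′ → j ≡ j′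
vertex-injective (m ∷ ms) zero    eq = ↑ˡ-injective _ _ _ eq
vertex-injective (m ∷ ms) (suc i) eq = vertex-injective ms i (↑ʳ-injective m _ _ eq)

vertex-surjective : ∀ {k} (ms : Vec ℕ k) x → ∃[ j ] vertex ms (block ms x) j ≡ x
vertex-surjective (m ∷ ms) x with splitAt m x in eq
... | inj₁ j = j , splitAt⁻¹-↑ˡ eq
... | inj₂ y = let j , vj≡y = vertex-surjective ms y in
               j , trans (cong (m ↑ʳ_) vj≡y) (splitAt⁻¹-↑ʳ eq)

-- The set A. Membership is a Boolean, so the decision of `m ≡ 1` serves as the common entry of a
-- whole block.
singletons : ∀ {k} (ms : Vec ℕ k) → Subset (Vec.sum ms)
singletons []       = []
singletons (m ∷ ms) = replicate m (does (m ℕ.≟ 1)) ++ singletons ms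

lookup-singletons : ∀ {k} (ms : Vec ℕ k) x →
                    lookup (singletons ms) x ≡ does (lookup ms (block ms x) ℕ.≟ 1)
lookup-singletons (m ∷ ms) x
  rewrite lookup-splitAt m (replicate m (does (m ℕ.≟ 1))) (singletons ms) x
  with splitAt m x
... | inj₁ j = lookup-replicate j _
... | inj₂ y = lookup-singletons ms y

∈-singletons⁺ : ∀ {k} (ms : Vec ℕ k) {x} → lookup ms (block ms x) ≡ 1 → x Subset.∈ singletons ms
∈-singletons⁺ ms {x} eq =
  lookup⇒[]= x _ (trans (lookup-singletons ms x) (dec-true (_ ℕ.≟ 1) eq))

∈-singletons⁻ : ∀ {k} (ms : Vec ℕ k) {x} → x Subset.∈ singletons ms → lookup ms (block ms x) ≡ 1
∈-singletons⁻ ms {x} x∈ = decidable-stable (_ ℕ.≟ 1) λ ≢1 →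
  contradiction (trans (sym ([]=⇒lookup x∈)) (trans (lookup-singletons ms x) (dec-false (_ ℕ.≟ 1) ≢1))) λ ()

∣singletons∣ : ∀ {k} (ms : Vec ℕ k) → ∣ singletons ms ∣ ≡ countOnes ms
∣singletons∣ []                 = refl
∣singletons∣ (0 ∷ ms)           = ∣singletons∣ ms
∣singletons∣ (1 ∷ ms)           = cong suc (∣singletons∣ ms)
∣singletons∣ (suc (suc m) ∷ ms) = trans
  (∣++∣ (replicate m outside) (singletons ms))
  (trans (cong (_+ _) (∣⊥∣≡0 m)) (∣singletons∣ ms))

-- Two vertices in the same block of size 1 have the same coordinates and so coincide.
singletons-universal : ∀ {k} (ms : Vec ℕ k) {x y} → x Subset.∈ singletons ms → x ≢ y →
                       Graph.Adj K[ ms ] x y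
singletons-universal ms {x} {y} x∈ x≢y eq
  with vertex-surjective ms x | vertex-surjective ms y
... | i , vi≡x | j , vj≡y =
  x≢y (trans (sym vi≡x) (trans (same eq (∈-singletons⁻ ms x∈) i j) vj≡y))
  where
  Fin1 : ∀ {m} → m ≡ 1 → (i j : Fin m) → i ≡ j
  Fin1 refl zero zero = refl

  -- The blocks are generalised to variables so that their equality can be matched with `refl`.
  same : ∀ {c d} → c ≡ d → lookup ms c ≡ 1 → ∀ i j → vertex ms c i ≡ vertex ms d j
  same refl ≡1 i j = cong (vertex ms _) (Fin1 ≡1 i j)

-- The position of x in its block rules out size 0, and `x∉` rules out size 1.
∉-singletons⇒2≤ : ∀ {k} (ms : Vec ℕ k) {x} → x Subset.∉ singletons ms → 2 ≤ lookup ms (block ms x)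
∉-singletons⇒2≤ ms {x} x∉ = go (proj₁ (vertex-surjective ms x)) (x∉ ∘ ∈-singletons⁺ ms)
  where
  go : ∀ {m} → Fin m → m ≢ 1 → 2 ≤ m
  go {1}           _ ≢1 = contradiction refl ≢1
  go {suc (suc m)} _ _  = s≤s (s≤s z≤n)

-- Counting, and the one block with at least two vertices

module _ {X : Set} {P : X → Set} (P? : Decidable P) where

  count≡0⇒¬ : ∀ {n} (xs : Vec X n) → count P? xs ≡ 0 → ∀ i → ¬ P (lookup xs i)
  count≡0⇒¬ (x ∷ xs) eq i p with P? x | i | eq
  ... | no ¬p | zero  | _  = ¬p p
  ... | no _  | suc i | eq = count≡0⇒¬ xs eq i p

  count≡1⇒unique : ∀ {n} (xs : Vec X n) → count P? xs ≡ 1 →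
                   ∀ {i j} → P (lookup xs i) → P (lookup xs j) → i ≡ j
  count≡1⇒unique (x ∷ xs) eq {i} {j} p q with P? x | i | j
  ... | _     | zero  | zero  = refl
  ... | no _  | suc i | suc j = cong suc (count≡1⇒unique xs eq p q)
  ... | no ¬p | zero  | suc _ = contradiction p ¬p
  ... | no ¬p | suc _ | zero  = contradiction q ¬p
  ... | yes _ | suc i | _     = contradiction p (count≡0⇒¬ xs (ℕ.suc-injective eq) i)
  ... | yes _ | zero  | suc j = contradiction q (count≡0⇒¬ xs (ℕ.suc-injective eq) j)

  count>0⇒∃ : ∀ {n} (xs : Vec X n) → 0 < count P? xs → ∃[ i ] P (lookup xs i)
  count>0⇒∃ (x ∷ xs) 0<c with P? x
  ... | yes p = zero , p
  ... | no _  = let i , p = count>0⇒∃ xs 0<c in suc i , p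

-- Both vertices lie in blocks of size at least two; since λ = 1, these are the same block.
non-singletons-independent : ∀ {k} (ms : Vec ℕ k) → countAtLeastTwo ms ≡ 1 →
  ∀ {x y} → x Subset.∉ singletons ms → y Subset.∉ singletons ms → ¬ Graph.Adj K[ ms ] x y
non-singletons-independent ms λ≡1 x∉ y∉ x~y =
  x~y (count≡1⇒unique (2 ℕ.≤?_) ms λ≡1 (∉-singletons⇒2≤ ms x∉) (∉-singletons⇒2≤ ms y∉))

distinct : ∀ {m} → 2 ≤ m → ∃[ j ] ∃[ j′ ] _≢_ {A = Fin m} j j′
distinct (s≤s (s≤s _)) = zero , suc zero , λ ()

two-non-singletons : ∀ {k} (ms : Vec ℕ k) i → 2 ≤ lookup ms i →
  ∃[ b ] ∃[ b′ ] b Subset.∉ singletons ms × b′ Subset.∉ singletons ms × b ≢ b′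
two-non-singletons ms i 2≤ with distinct 2≤
... | j , j′ , j≢j′ = vertex ms i j , vertex ms i j′ , ∉ j , ∉ j′ , j≢j′ ∘ vertex-injective ms i
  where
  ∉ : ∀ j → vertex ms i j Subset.∉ singletons ms
  ∉ j ∈s = ℕ.<⇒≢ 2≤ (sym (subst (λ i′ → lookup ms i′ ≡ 1) (block-vertex ms i j) (∈-singletons⁻ ms ∈s)))

proposition5p8 : ∀ {k} (ms : Vec ℕ (suc k)) →
    2 ≤ suc k →
    1 ≤ head ms →
    Linked _≤_ ms →
    2 ≤ last ms →
    countAtLeastTwo ms ≡ 1 →
    nim (DNT K[ ms ]) ≡ pty (countOnes ms) ×
    nim (TER K[ ms ]) ≡ 1 + pty (countOnes ms)
proposition5p8 ms _ _ _ _ λ≡1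
  -- λ = 1 provides the large block. Its vertices b and b′ span geodesics through all of A, and b is
  -- also the move that ends TER from any position inside A.
  with count>0⇒∃ (2 ℕ.≤?_) ms (≤-reflexive (sym λ≡1))
... | i , 2≤ with two-non-singletons ms i 2≤
... | b , b′ , b∉ , b′∉ , b≢b′ =
  trans (nim-DNT generating⇒⊆ ⊆⇒generating) (cong pty (∣singletons∣ ms)) ,
  trans (nim-TER generating⇒⊆ ⊆⇒generating b∉) (cong ((1 +_) ∘ pty) (∣singletons∣ ms))
  where
  A = singletons ms

  generating⇒⊆ : ∀ P → Generating K[ ms ] (∁ P) → P Subset.⊆ A
  generating⇒⊆ = generating⇒⊆universal K[ ms ] A
    (singletons-universal ms) (non-singletons-independent ms λ≡1)

  ⊆⇒generating : ∀ P → P Subset.⊆ A → Generating K[ ms ] (∁ P)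
  ⊆⇒generating = ⊆universal⇒generating K[ ms ] A
    (singletons-universal ms) (non-singletons-independent ms λ≡1) b∉ b′∉ b≢b′
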